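{- For every finite graph $G$ with maximum degree $\Delta\ge 300$, $\pi_{\operatorname{T_wch}}(G)\le \lceil 4.25\Delta\rceil$.
   Context: A sequence $s_1\ldots s_{2k}$ ($k\ge1$) is a square if $s_i=s_{i+k}$ for all $i$; a sequence is non-repetitive if it has no consecutive subsequence that is a square. The elements of a graph are its vertices and edges. A mixed-path is an alternating sequence of vertices and edges in which consecutive elements are incident, and no element appears twice. A coloring of all vertices and edges of $G$ is a weak total Thue coloring if the color sequence of every mixed-path is non-repetitive. A list assignment $L$ assigns to each vertex and each edge a set of colors. $\pi_{\operatorname{T_wch}}(G)$ is the smallest $l$ such that for every list assignment with all lists of size at least $l$ there is a weak total Thue coloring in which every element $x$ receives a color from $L(x)$. -}

module Defs where

open import Data.Nat using (ℕ; zero; suc; _+_; _*_; _≤_; _/_)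
open import Data.Fin using (Fin)
open import Data.Fin.Properties using (_≟_)
open import Data.List using (List; []; _∷_; _++_; length; filter; allFin; map)
open import Data.List.Membership.Propositional using (_∈_)
open import Data.List.Relation.Unary.Unique.Propositional using (Unique)
open import Data.List.Relation.Unary.Linked using (Linked)
open import Data.Product using (Σ; ∃; _×_; _,_; proj₁; proj₂)
open import Data.Sum using (_⊎_; inj₁; inj₂)
open import Data.Empty using (⊥)
open import Relation.Nullary using (¬_)
open import Relation.Nullary.Decidable using (_⊎-dec_)
open import Relation.Binary.PropositionalEquality using (_≡_; _≢_)

record Graph : Set where
  field
    n     : ℕ
    m     : ℕ
    ends  : Fin m → Fin n × Fin n
    loopless : ∀ e → proj₁ (ends e) ≢ proj₂ (ends e)
    simple   : ∀ e f →
      ((proj₁ (ends e) ≡ proj₁ (ends f) × proj₂ (ends e) ≡ proj₂ (ends f))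
       ⊎ (proj₁ (ends e) ≡ proj₂ (ends f) × proj₂ (ends e) ≡ proj₁ (ends f)))
      → e ≡ f

  Vertex : Set
  Vertex = Fin n

  Edge : Set
  Edge = Fin m

  EndOf : Vertex → Edge → Set
  EndOf v e = v ≡ proj₁ (ends e) ⊎ v ≡ proj₂ (ends e)

  degree : Vertex → ℕ
  degree v = length (filter (λ e → (v ≟ proj₁ (ends e)) ⊎-dec (v ≟ proj₂ (ends e))) (allFin m))

  Element : Set
  Element = Vertex ⊎ Edge

  Incident : Element → Element → Set
  Incident (inj₁ v) (inj₂ e) = EndOf v e
  Incident (inj₂ e) (inj₁ v) = EndOf v e
  Incident (inj₁ _) (inj₁ _) = ⊥
  Incident (inj₂ _) (inj₂ _) = ⊥

  MixedPath : List Element → Set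
  MixedPath P = Linked Incident P × Unique P

open Graph public

MaxDegree : Graph → ℕ → Set
MaxDegree G Δ = (∀ v → degree G v ≤ Δ) × ∃ λ v → degree G v ≡ Δ

NonRepetitive : List ℕ → Set
NonRepetitive s = ¬ (Σ (List ℕ) λ pre → Σ (List ℕ) λ xs → Σ (List ℕ) λ suf →
                      (xs ≢ []) × (s ≡ pre ++ (xs ++ xs) ++ suf))

WeakTotalThue : (G : Graph) → (Element G → ℕ) → Set
WeakTotalThue G c = ∀ P → MixedPath G P → NonRepetitive (map c P)

Lists≥ : (G : Graph) → ℕ → (Element G → List ℕ) → Set
Lists≥ G l L = ∀ x → Unique (L x) × l ≤ length (L x)

-- G admits a weak total Thue coloring from every list assignment with
-- lists of size ≥ l;  i.e.  π_{T_wch}(G) ≤ l  (the property is monotone in l)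
WeakTotalThueChoosable : Graph → ℕ → Set
WeakTotalThueChoosable G l =
  ∀ (L : Element G → List ℕ) → Lists≥ G l L →
  Σ (Element G → ℕ) λ c → (∀ x → c x ∈ L x) × WeakTotalThue G c

-- ⌈ 4.25 Δ ⌉ = ⌈ 17Δ / 4 ⌉ = ⌊ (17Δ + 3) / 4 ⌋
ceil425 : ℕ → ℕ
ceil425 Δ = (17 * Δ + 3) / 4

{-# OPTIONS --safe #-}

-- Rosenfeld's counting argument. Give each vertex the weight β = 2Δ and each edge the weight
-- β = 4Δ. Among all choices ω of one colour per element, let V(S) be the number of those in which
-- no mixed path inside S carries a square. If x ∉ S, then β(x) V(S) ≤ ℓ V(S ∪ {x}), by induction
-- on |S|: a choice counted by V(S) but not by V(S ∪ {x}) has a square whose half h, containing x,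
-- can be recoloured freely, so a given square accounts for at most V(S ∖ h) / ℓ^|h| choices, which
-- is at most V(S) / (ℓ ∏ β(y)) with y ranging over h ∖ {x}.
-- There are at most k Δ^k squares of half-length k through a vertex and 2k Δ^(k-1) through an
-- edge, and two consecutive elements have weights with product 8Δ²; summing over k gives at
-- most (9/4)Δ V(S) / ℓ, respectively 9 V(S) / ℓ, bad choices, so ℓ ≥ (17/4)Δ suffices.
module Submission where

open import Defs
open import Data.Bool using (if_then_else_)
open import Data.Fin as Fin using (Fin; zero; suc)
import Data.Fin.Properties as Fin
open import Data.List as List using (List; []; _∷_; [_]; _++_; _ʳ++_; map; concat; concatMap; length; filter; reverse; zip; take; drop; upTo; applyUpTo; cartesianProduct; allFin)
open import Data.List.Properties using (map-++; map-∘; map-cong; length-map; length-++; length-filter; length-reverse; length-upTo; map-upTo; reverse-++; reverse-involutive; reverse-map; ++-assoc; ∷-injectiveˡ; ∷-injectiveʳ; filter-notAll)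
open import Data.List.Membership.Propositional using (_∈_; _∉_; find; lose)
open import Data.List.Membership.Propositional.Properties
open import Data.List.Relation.Binary.Permutation.Propositional using (_↭_; ↭-sym; ↭⇒↭ₛ)
open import Data.List.Relation.Binary.Permutation.Propositional.Properties using (All-resp-↭; ∈-resp-↭; shift; ↭-reverse) renaming (map⁺ to ↭-map⁺; ++⁺ to ↭-++⁺)
import Data.List.Relation.Binary.Permutation.Setoid.Properties as Permutation
open import Data.List.Relation.Binary.Subset.Propositional using (_⊆_)
open import Data.List.Relation.Unary.All as All using (All; []; _∷_; all?)
import Data.List.Relation.Unary.All.Properties as All
open import Data.List.Relation.Unary.AllPairs as AllPairs using ([]; _∷_; allPairs?)
open import Data.List.Relation.Unary.Any using (here; there; any?)
import Data.List.Relation.Unary.Any.Properties as Any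
open import Data.List.Relation.Unary.Linked as Linked using (Linked; []; [-]; _∷_; linked?)
open import Data.List.Relation.Unary.Unique.Propositional using (Unique)
import Data.List.Relation.Unary.Unique.Propositional.Properties as Unique
open import Data.Nat using (ℕ; zero; suc; _+_; _*_; _^_; _∸_; _≤_; _<_; z≤n; s≤s; z<s; _%_; NonZero; >-nonZero; ⌊_/2⌋; ⌈_/2⌉)
open import Data.Nat.DivMod using (m≡m%n+[m/n]*n; m%n<n)
open import Data.Nat.Induction using (<-wellFounded)
open import Data.Nat.ListAction using (sum; product)
open import Data.Nat.ListAction.Properties using (sum-++; product-↭)
open import Data.Nat.Properties
open import Data.Nat.Tactic.RingSolver using (solve-∀)
open import Data.Product using (∃; ∃₂; _×_; _,_; proj₁; proj₂)
open import Data.Sum using (_⊎_; inj₁; inj₂; [_,_]′)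
import Data.Sum.Properties as Sum
open import Data.Vec using (Vec; []; _∷_; lookup; _[_]≔_; tabulate)
open import Data.Vec.Properties using (lookup∘update; lookup∘update′; lookup∘tabulate)
open import Function using (case_of_; _∘_; id; _↔_; Inverse)
open import Function.Properties.Inverse using (↔-sym)
open import Induction.WellFounded using (Acc; acc)
open import Relation.Binary.Definitions using (Symmetric)
open import Relation.Binary.PropositionalEquality
  using (_≡_; _≢_; refl; sym; trans; cong; cong₂; subst; subst₂; setoid; module ≡-Reasoning)
open import Relation.Nullary using (¬_; Dec; yes; no; does; contradiction)
open import Relation.Nullary.Decidable using (¬?; _×-dec_; _⊎-dec_; _→-dec_; dec-true; map′; toSum)
open import Relation.Unary using (Decidable)

-- Sums and counts over lists

module _ {A : Set} where

  ∑ : (A → ℕ) → List A → ℕ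
  ∑ f xs = sum (map f xs)

  ∑-++ : ∀ f xs ys → ∑ f (xs ++ ys) ≡ ∑ f xs + ∑ f ys
  ∑-++ f xs ys = trans (cong sum (map-++ f xs ys)) (sum-++ (map f xs) (map f ys))

  ∑-mono-∈ : ∀ {f g : A → ℕ} xs → (∀ {x} → x ∈ xs → f x ≤ g x) → ∑ f xs ≤ ∑ g xs
  ∑-mono-∈ []       f≤g = z≤n
  ∑-mono-∈ (x ∷ xs) f≤g = +-mono-≤ (f≤g (here refl)) (∑-mono-∈ xs (f≤g ∘ there))

  ∑-mono : ∀ {f g : A → ℕ} xs → (∀ x → f x ≤ g x) → ∑ f xs ≤ ∑ g xs
  ∑-mono xs f≤g = ∑-mono-∈ xs (λ {x} _ → f≤g x)

  ∑-cong : ∀ {f g : A → ℕ} xs → (∀ x → f x ≡ g x) → ∑ f xs ≡ ∑ g xs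
  ∑-cong xs f≡g = cong sum (map-cong f≡g xs)

  ∑-distrib-+ : ∀ (f g : A → ℕ) xs → ∑ (λ x → f x + g x) xs ≡ ∑ f xs + ∑ g xs
  ∑-distrib-+ f g []       = refl
  ∑-distrib-+ f g (x ∷ xs) = trans (cong (f x + g x +_) (∑-distrib-+ f g xs))
    (interchange (f x) (g x) (∑ f xs) (∑ g xs))
    where
    interchange : ∀ a b c d → a + b + (c + d) ≡ a + c + (b + d)
    interchange = solve-∀

  ∑-distrib-*ˡ : ∀ c (f : A → ℕ) xs → ∑ (λ x → c * f x) xs ≡ c * ∑ f xs
  ∑-distrib-*ˡ c f []       = sym (*-zeroʳ c)
  ∑-distrib-*ˡ c f (x ∷ xs) =
    trans (cong (c * f x +_) (∑-distrib-*ˡ c f xs)) (sym (*-distribˡ-+ c (f x) (∑ f xs)))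

  ∑-const : ∀ c xs → ∑ (λ _ → c) xs ≡ length xs * c
  ∑-const c []       = refl
  ∑-const c (x ∷ xs) = cong (c +_) (∑-const c xs)

  ∑-≤-const : ∀ {f : A → ℕ} {c} xs → (∀ {x} → x ∈ xs → f x ≤ c) → ∑ f xs ≤ length xs * c
  ∑-≤-const {c = c} xs f≤c = ≤-trans (∑-mono-∈ xs f≤c) (≤-reflexive (∑-const c xs))

  term≤∑ : ∀ (f : A → ℕ) {x xs} → x ∈ xs → f x ≤ ∑ f xs
  term≤∑ f (here refl) = m≤m+n _ _
  term≤∑ f (there x∈)  = ≤-trans (term≤∑ f x∈) (m≤n+m _ _)

  0<∑⇒∃ : ∀ (f : A → ℕ) xs → 0 < ∑ f xs → ∃ λ x → x ∈ xs × 0 < f x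
  0<∑⇒∃ f (x ∷ xs) 0<∑ with f x in fx≡
  ... | suc _ = x , here refl , subst (0 <_) (sym fx≡) z<s
  ... | zero with y , y∈ , 0<fy ← 0<∑⇒∃ f xs 0<∑ = y , there y∈ , 0<fy

∑-swap : ∀ {A B : Set} (f : A → B → ℕ) xs ys →
  ∑ (λ x → ∑ (f x) ys) xs ≡ ∑ (λ y → ∑ (λ x → f x y) xs) ys
∑-swap f []       ys = sym (trans (∑-const 0 ys) (*-zeroʳ (length ys)))
∑-swap f (x ∷ xs) ys = trans (cong (∑ (f x) ys +_) (∑-swap f xs ys))
  (sym (∑-distrib-+ (f x) (λ y → ∑ (λ z → f z y) xs) ys))

∑-map : ∀ {A B : Set} (f : B → ℕ) (g : A → B) xs → ∑ f (map g xs) ≡ ∑ (f ∘ g) xs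
∑-map f g xs = cong sum (sym (map-∘ xs))

∑-concat : ∀ {A : Set} (f : A → ℕ) xss → ∑ f (concat xss) ≡ ∑ (∑ f) xss
∑-concat f []         = refl
∑-concat f (xs ∷ xss) = trans (∑-++ f xs (concat xss)) (cong (∑ f xs +_) (∑-concat f xss))

𝟙 : {P : Set} → Dec P → ℕ
𝟙 P? = if does P? then 1 else 0

𝟙-yes : {P : Set} (P? : Dec P) → P → 𝟙 P? ≡ 1
𝟙-yes P? p = cong (if_then 1 else 0) (dec-true P? p)

𝟙-pos : {P : Set} (P? : Dec P) → 0 < 𝟙 P? → P
𝟙-pos (yes p) _ = p

𝟙-elim : {P : Set} {n : ℕ} (P? : Dec P) → (P → 1 ≤ n) → 𝟙 P? ≤ n
𝟙-elim (yes p) 1≤n = 1≤n p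
𝟙-elim (no _)  _   = z≤n

module _ {A : Set} where

  count : {P : A → Set} → Decidable P → List A → ℕ
  count P? = ∑ (𝟙 ∘ P?)

  module _ {P Q : A → Set} (P? : Decidable P) (Q? : Decidable Q) where

    count-mono : ∀ xs → (∀ x → P x → Q x) → count P? xs ≤ count Q? xs
    count-mono xs P⊆Q =
      ∑-mono xs λ x → 𝟙-elim (P? x) (≤-reflexive ∘ sym ∘ 𝟙-yes (Q? x) ∘ P⊆Q x)

    -- Union bound: where `P` holds, `Q` or one of the `R b` contributes at least 1, and exchanging
    -- the two sums turns these contributions into counts.
    count-union : {B : Set} {R : B → A → Set} (R? : ∀ b → Decidable (R b)) (bs : List B) → ∀ xs →
      (∀ x → P x → Q x ⊎ ∃ λ b → b ∈ bs × R b x) →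
      count P? xs ≤ count Q? xs + ∑ (λ b → count (R? b) xs) bs
    count-union R? bs xs cover = begin
      count P? xs                                             ≤⟨ ∑-mono xs pointwise ⟩
      ∑ (λ x → 𝟙 (Q? x) + ∑ (λ b → 𝟙 (R? b x)) bs) xs         ≡⟨ ∑-distrib-+ _ _ xs ⟩
      count Q? xs + ∑ (λ x → ∑ (λ b → 𝟙 (R? b x)) bs) xs      ≡⟨ cong (count Q? xs +_) (∑-swap _ xs bs) ⟩
      count Q? xs + ∑ (λ b → count (R? b) xs) bs              ∎
      where
      open ≤-Reasoning
      pointwise : ∀ x → 𝟙 (P? x) ≤ 𝟙 (Q? x) + ∑ (λ b → 𝟙 (R? b x)) bs
      pointwise x = 𝟙-elim (P? x) λ p → case-cover (cover x p)
        where
        case-cover : Q x ⊎ _ → 1 ≤ 𝟙 (Q? x) + ∑ (λ b → 𝟙 (R? b x)) bs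
        case-cover (inj₁ q)            = ≤-trans (≤-reflexive (sym (𝟙-yes (Q? x) q))) (m≤m+n _ _)
        case-cover (inj₂ (b , b∈ , r)) = ≤-trans
          (≤-trans (≤-reflexive (sym (𝟙-yes (R? b x) r))) (term≤∑ (λ b → 𝟙 (R? b x)) b∈))
          (m≤n+m _ _)

  count-const : {P : A → Set} (P? : Decidable P) → ∀ xs → (∀ x → P x) → count P? xs ≡ length xs
  count-const P? xs all = trans (∑-cong xs (λ x → 𝟙-yes (P? x) (all x)))
    (trans (∑-const 1 xs) (*-identityʳ (length xs)))

  count-none : {P : A → Set} (P? : Decidable P) → ∀ xs → (∀ {x} → x ∈ xs → ¬ P x) → count P? xs ≡ 0
  count-none P? xs none = n≤0⇒n≡0 (≤-trans
    (∑-mono-∈ xs λ {x} x∈ → 𝟙-elim {n = 0} (P? x) λ p → contradiction p (none x∈))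
    (≤-reflexive (trans (∑-const 0 xs) (*-zeroʳ (length xs)))))

  -- Two counted positions would both hold `y`, against `Unique`. This is how a forced colour comes
  -- to cost a full factor of the list size.
  count-single : {P : A → Set} (P? : Decidable P) (y : A) → ∀ {xs} → Unique xs →
    (∀ {x} → P x → x ≡ y) → count P? xs ≤ 1
  count-single P? y []                    P⇒y = z≤n
  count-single P? y (_∷_ {x} {xs} x∉ uxs) P⇒y with P? x
  ... | no  _ = count-single P? y uxs P⇒y
  ... | yes p = s≤s (≤-reflexive (count-none P? xs λ z∈ q →
                  All.lookup x∉ z∈ (trans (P⇒y p) (sym (P⇒y q)))))

-- Choices of one colour per coordinate

choices : ∀ {N} → Vec (List ℕ) N → List (Vec ℕ N)
choices []       = [ [] ]
choices (L ∷ Ls) = concatMap (λ a → map (a ∷_) (choices Ls)) L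

∑-choices-∷ : ∀ {N} (f : Vec ℕ (suc N) → ℕ) L (Ls : Vec (List ℕ) N) →
  ∑ f (choices (L ∷ Ls)) ≡ ∑ (λ a → ∑ (λ ω → f (a ∷ ω)) (choices Ls)) L
∑-choices-∷ f L Ls = begin
  ∑ f (concat (map (λ a → map (a ∷_) (choices Ls)) L)) ≡⟨ ∑-concat f (map _ L) ⟩
  ∑ (∑ f) (map (λ a → map (a ∷_) (choices Ls)) L)      ≡⟨ ∑-map (∑ f) _ L ⟩
  ∑ (λ a → ∑ f (map (a ∷_) (choices Ls))) L            ≡⟨ ∑-cong L (λ a → ∑-map f (a ∷_) (choices Ls)) ⟩
  ∑ (λ a → ∑ (λ ω → f (a ∷ ω)) (choices Ls)) L         ∎
  where open ≡-Reasoning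

-- Overwriting coordinate `i` forgets its old value, so each choice arises once for every old value,
-- that is, as often as the `i`-th list is long.
resample : ∀ {N} (Ls : Vec (List ℕ) N) i (f : Vec ℕ N → ℕ) →
  ∑ (λ ω → ∑ (λ a → f (ω [ i ]≔ a)) (lookup Ls i)) (choices Ls)
    ≡ length (lookup Ls i) * ∑ f (choices Ls)
resample (L ∷ Ls) zero f = begin
  ∑ (λ ω → ∑ (λ a → f (ω [ zero ]≔ a)) L) (choices (L ∷ Ls))      ≡⟨ ∑-choices-∷ _ L Ls ⟩
  ∑ (λ _ → ∑ (λ ω → ∑ (λ a → f (a ∷ ω)) L) (choices Ls)) L       ≡⟨ ∑-const _ L ⟩
  length L * ∑ (λ ω → ∑ (λ a → f (a ∷ ω)) L) (choices Ls)        ≡⟨ cong (length L *_) (∑-swap _ (choices Ls) L) ⟩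
  length L * ∑ (λ a → ∑ (λ ω → f (a ∷ ω)) (choices Ls)) L        ≡⟨ cong (length L *_) (∑-choices-∷ f L Ls) ⟨
  length L * ∑ f (choices (L ∷ Ls))                               ∎
  where open ≡-Reasoning
resample (L ∷ Ls) (suc i) f = begin
  ∑ (λ ω → ∑ (λ a → f (ω [ suc i ]≔ a)) M) (choices (L ∷ Ls))             ≡⟨ ∑-choices-∷ _ L Ls ⟩
  ∑ (λ b → ∑ (λ ω → ∑ (λ a → f (b ∷ ω [ i ]≔ a)) M) (choices Ls)) L       ≡⟨ ∑-cong L (λ b → resample Ls i (f ∘ (b ∷_))) ⟩
  ∑ (λ b → length M * ∑ (λ ω → f (b ∷ ω)) (choices Ls)) L                 ≡⟨ ∑-distrib-*ˡ (length M) _ L ⟩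
  length M * ∑ (λ b → ∑ (λ ω → f (b ∷ ω)) (choices Ls)) L                 ≡⟨ cong (length M *_) (∑-choices-∷ f L Ls) ⟨
  length M * ∑ f (choices (L ∷ Ls))                                       ∎
  where
  open ≡-Reasoning
  M = lookup Ls i

choices-nonempty : ∀ {N} (Ls : Vec (List ℕ) N) → (∀ i → 0 < length (lookup Ls i)) → 0 < length (choices Ls)
choices-nonempty []             _  = z<s
choices-nonempty ([] ∷ Ls)      0< with () ← 0< zero
choices-nonempty ((a ∷ L) ∷ Ls) 0< = begin
  1                                                       ≤⟨ choices-nonempty Ls (0< ∘ suc) ⟩
  length (choices Ls)                                     ≡⟨ length-map (a ∷_) (choices Ls) ⟨
  length (map (a ∷_) (choices Ls))                        ≤⟨ m≤m+n _ _ ⟩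
  length (map (a ∷_) (choices Ls)) + length (concatMap (λ a → map (a ∷_) (choices Ls)) L) ≡⟨ length-++ (map (a ∷_) (choices Ls)) ⟨
  length (choices ((a ∷ L) ∷ Ls))                         ∎
  where open ≤-Reasoning

choices-lookup : ∀ {N} (Ls : Vec (List ℕ) N) {ω} → ω ∈ choices Ls → ∀ i → lookup ω i ∈ lookup Ls i
choices-lookup (L ∷ Ls) ω∈ i
  with a , a∈ , ω∈′ ← find (∈-concatMap⁻ (λ a → map (a ∷_) (choices Ls)) {xs = L} ω∈)
  with ω′ , ω′∈ , refl ← ∈-map⁻ (a ∷_) ω∈′
  with i
... | zero  = a∈
... | suc j = choices-lookup Ls ω′∈ j

-- The counting argument

Unique-resp-↭ : ∀ {A : Set} {xs ys : List A} → xs ↭ ys → Unique xs → Unique ys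
Unique-resp-↭ {A} p = Permutation.Unique-resp-↭ (setoid A) (↭⇒↭ₛ p)

Unique-++⁻ˡ : ∀ {A : Set} (xs : List A) {ys} → Unique (xs ++ ys) → Unique xs
Unique-++⁻ˡ []       _         = []
Unique-++⁻ˡ (x ∷ xs) (x∉ ∷ u) = All.++⁻ˡ xs x∉ ∷ Unique-++⁻ˡ xs u

module _ {X : Set} where

  -- Encodes a square: the pairs join the i-th element of the first half to the i-th of the second.
  -- The `support` of a square is then the path itself.
  Event : Set
  Event = List (X × X)

  support : Event → List X
  support ev = map proj₁ ev ++ map proj₂ ev

  Matched : (X → ℕ) → Event → Set
  Matched c = All (λ p → c (proj₁ p) ≡ c (proj₂ p))

  Inside : List X → Event → Set
  Inside S ev = All (_∈ S) (support ev)

  matched? : ∀ c ev → Dec (Matched c ev)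
  matched? c = all? (λ p → c (proj₁ p) ≟ c (proj₂ p))

  matched-cong : ∀ {c d : X → ℕ} ev → (∀ {x} → x ∈ support ev → c x ≡ d x) → Matched c ev → Matched d ev
  matched-cong ev c≗d m = All.tabulate λ {p} p∈ →
    trans (sym (c≗d (∈-++⁺ˡ (∈-map⁺ proj₁ p∈))))
      (trans (All.lookup m p∈) (c≗d (∈-++⁺ʳ (map proj₁ ev) (∈-map⁺ proj₂ p∈))))

-- All that the counting has to know about squares. The list `events x` holds those with `x` in the
-- first half, so that `x` is among the elements to be recoloured.
record EventSystem (X : Set) (ℓ : ℕ) : Set where
  field
    β        : X → ℕ
    events   : X → List (Event {X})
    unique   : ∀ {x ev} → ev ∈ events x → Unique (support ev)
    first    : ∀ {x ev} → ev ∈ events x → x ∈ map proj₁ ev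
    -- Whatever is forbidden at `z` and involves `x` is already forbidden by an event listed at `x`.
    -- Hence only `events x` matter when `x` is added to a set.
    transfer : ∀ {x z ev} → ev ∈ events z → x ∈ support ev →
      ∃ λ ev′ → ev′ ∈ events x × support ev′ ⊆ support ev × (∀ c → Matched c ev → Matched c ev′)
    -- A summation-free way to say Σ 1 / (∏ β over the first half without x) ≤ ℓ − β x, sum over events at x.
    sparse   : ∀ x (f : Event → ℕ) W →
      (∀ {ev} → ev ∈ events x → ℓ * f ev * product (map β (map proj₁ ev)) ≤ β x * W) →
      ℓ * ∑ f (events x) + β x * W ≤ ℓ * W
    β-pos    : ∀ x → 0 < β x
    ℓ-pos    : 0 < ℓ

module Counting {X : Set} {N : ℕ} (X↔Fin : X ↔ Fin N) {ℓ : ℕ} (system : EventSystem X ℓ)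
  (L : X → List ℕ) (L-unique : ∀ x → Unique (L x)) (L-large : ∀ x → ℓ ≤ length (L x)) where

  open EventSystem system
  open Inverse X↔Fin using (to; from; strictlyInverseˡ; strictlyInverseʳ)

  to-injective : ∀ {x y} → to x ≡ to y → x ≡ y
  to-injective {x} {y} eq = trans (sym (strictlyInverseʳ x)) (trans (cong from eq) (strictlyInverseʳ y))

  _≟X_ : (x y : X) → Dec (x ≡ y)
  x ≟X y = map′ to-injective (cong to) (to x Fin.≟ to y)

  open import Data.List.Membership.DecPropositional _≟X_ using (_∈?_)

  lists : Vec (List ℕ) N
  lists = tabulate (L ∘ from)

  lookup-lists : ∀ x → lookup lists (to x) ≡ L x
  lookup-lists x = trans (lookup∘tabulate (L ∘ from) (to x)) (cong L (strictlyInverseʳ x))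

  Ω : List (Vec ℕ N)
  Ω = choices lists

  colour : Vec ℕ N → X → ℕ
  colour ω x = lookup ω (to x)

  colour-update : ∀ ω {x y} a → x ≢ y → colour (ω [ to y ]≔ a) x ≡ colour ω x
  colour-update ω a x≢y = lookup∘update′ (x≢y ∘ to-injective) ω a

  -- Among the colours in `L y` that `ω` may receive at `y`, at most one leads to `P`, namely `g ω`,
  -- and only if `Q ω` holds. By `resample`, the sum of these numbers is the list size times the
  -- count of `P`.
  count-determined : ∀ y {P Q : Vec ℕ N → Set} (P? : Decidable P) (Q? : Decidable Q) (g : Vec ℕ N → ℕ) →
    (∀ ω a → P (ω [ to y ]≔ a) → Q ω × a ≡ g ω) → ℓ * count P? Ω ≤ count Q? Ω
  count-determined y P? Q? g determined = begin
    ℓ * count P? Ω                                            ≤⟨ *-monoˡ-≤ _ (L-large y) ⟩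
    length (L y) * count P? Ω                                 ≡⟨ cong (λ M → length M * count P? Ω) (lookup-lists y) ⟨
    length (lookup lists (to y)) * count P? Ω                 ≡⟨ resample lists (to y) (𝟙 ∘ P?) ⟨
    ∑ (λ ω → count (λ a → P? (ω [ to y ]≔ a)) (lookup lists (to y))) Ω
                                                              ≡⟨ cong (λ M → ∑ (λ ω → count (λ a → P? (ω [ to y ]≔ a)) M) Ω) (lookup-lists y) ⟩
    ∑ (λ ω → count (λ a → P? (ω [ to y ]≔ a)) (L y)) Ω        ≤⟨ ∑-mono Ω pointwise ⟩
    count Q? Ω                                                ∎
    where
    open ≤-Reasoning
    pointwise : ∀ ω → count (λ a → P? (ω [ to y ]≔ a)) (L y) ≤ 𝟙 (Q? ω)
    pointwise ω with Q? ω
    ... | yes _ = count-single (λ a → P? (ω [ to y ]≔ a)) (g ω) (L-unique y) (λ {a} → proj₂ ∘ determined ω a)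
    ... | no ¬q = ≤-reflexive (count-none (λ a → P? (ω [ to y ]≔ a)) (L y) (λ {a} _ → ¬q ∘ proj₁ ∘ determined ω a))

  -- Valid choices and their growth

  Valid : List X → (X → ℕ) → Set
  Valid S c = All (λ x → All (λ ev → Inside S ev → ¬ Matched c ev) (events x)) S

  valid? : ∀ S c → Dec (Valid S c)
  valid? S c = all? (λ x → all? (λ ev → all? (_∈? S) (support ev) →-dec ¬? (matched? c ev)) (events x)) S

  -- Validity tests only events whose whole support lies in `S`, so the colours outside `S` can
  -- change freely.
  valid-cong : ∀ {S c d} → (∀ {x} → x ∈ S → c x ≡ d x) → Valid S c → Valid S d
  valid-cong {c = c} {d} c≗d = All.map (All.map λ {ev} v ins m →
    v ins (matched-cong {c = d} {c} ev (λ x∈ → sym (c≗d (All.lookup ins x∈))) m))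

  valid-antitone : ∀ {S T c} → S ⊆ T → Valid T c → Valid S c
  valid-antitone S⊆T v = All.tabulate λ x∈ → All.map (λ w ins → w (All.map S⊆T ins)) (All.lookup v (S⊆T x∈))

  #valid : List X → ℕ
  #valid S = count (valid? S ∘ colour) Ω

  #valid-antitone : ∀ {S T} → S ⊆ T → #valid T ≤ #valid S
  #valid-antitone {S} {T} S⊆T = count-mono (valid? T ∘ colour) (valid? S ∘ colour) Ω λ ω → valid-antitone {c = colour ω} S⊆T

  -- Induction over the pairs. The first component `y` lies outside `S` and occurs nowhere else in
  -- the event, so recolouring it affects neither validity nor the other pairs, while its own pair
  -- forces its colour. Each pair thus costs a factor `ℓ`.
  count-matched : ∀ S ev → Unique (support ev) → All (_∉ S) (map proj₁ ev) →
    ℓ ^ length ev * count (λ ω → valid? S (colour ω) ×-dec matched? (colour ω) ev) Ω ≤ #valid S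
  count-matched S [] _ _ = ≤-trans (≤-reflexive (*-identityˡ _)) (count-mono
    (λ ω → valid? S (colour ω) ×-dec matched? (colour ω) []) (valid? S ∘ colour) Ω λ _ → proj₁)
  count-matched S ((y , z) ∷ ev) (y∉ev ∷ u) (y∉S ∷ ∉S) = begin
    ℓ * ℓ ^ length ev * count P? Ω     ≡⟨ cong (_* count P? Ω) (*-comm ℓ _) ⟩
    ℓ ^ length ev * ℓ * count P? Ω     ≡⟨ *-assoc (ℓ ^ length ev) ℓ _ ⟩
    ℓ ^ length ev * (ℓ * count P? Ω)   ≤⟨ *-monoʳ-≤ (ℓ ^ length ev) (count-determined y P? Q? (λ ω → colour ω z) determined) ⟩
    ℓ ^ length ev * count Q? Ω         ≤⟨ count-matched S ev unique-ev ∉S ⟩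
    #valid S                           ∎
    where
    open ≤-Reasoning
    P? = λ ω → valid? S (colour ω) ×-dec matched? (colour ω) ((y , z) ∷ ev)
    Q? = λ ω → valid? S (colour ω) ×-dec matched? (colour ω) ev

    to-front : map proj₁ ev ++ z ∷ map proj₂ ev ↭ z ∷ support ev
    to-front = shift z (map proj₁ ev) (map proj₂ ev)

    unique-ev : Unique (support ev)
    unique-ev with _ ∷ u′ ← Unique-resp-↭ to-front u = u′

    y∉ : All (y ≢_) (z ∷ support ev)
    y∉ = All-resp-↭ to-front y∉ev

    determined : ∀ ω a → Valid S (colour (ω [ to y ]≔ a)) × Matched (colour (ω [ to y ]≔ a)) ((y , z) ∷ ev) →
      (Valid S (colour ω) × Matched (colour ω) ev) × a ≡ colour ω z
    determined ω a (v , (eq ∷ m)) =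
      ( valid-cong {c = colour (ω [ to y ]≔ a)} {colour ω} (λ x∈ → colour-update ω a (λ { refl → y∉S x∈ })) v
      , matched-cong {c = colour (ω [ to y ]≔ a)} {colour ω} ev (λ x∈ → colour-update ω a (All.lookup y∉ (there x∈) ∘ sym)) m ) ,
      trans (sym (lookup∘update (to y) ω a)) (trans eq (colour-update ω a (All.lookup y∉ (here refl) ∘ sym)))

  infixl 6 _-_ _∖_

  _-_ : List X → X → List X
  S - y = filter (λ s → ¬? (s ≟X y)) S

  _∖_ : List X → List X → List X
  S ∖ []       = S
  S ∖ (y ∷ ys) = S - y ∖ ys

  ∈-∖⁻ : ∀ S ys {x} → x ∈ S ∖ ys → x ∈ S × x ∉ ys
  ∈-∖⁻ S []       x∈ = x∈ , λ ()
  ∈-∖⁻ S (y ∷ ys) x∈ with x∈-y , x∉ys ← ∈-∖⁻ (S - y) ys x∈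
    with x∈S , x≢y ← ∈-filter⁻ (λ s → ¬? (s ≟X y)) x∈-y =
    x∈S , λ { (here eq) → x≢y eq ; (there x∈ys) → x∉ys x∈ys }

  -- A choice counted by `#valid S` also colours the elements outside `S`, so adding `x` can only
  -- lose choices. The claim is that a share of at least `β x / ℓ` survives, written without
  -- division.
  Grows : List X → Set
  Grows S = ∀ x → x ∉ S → β x * #valid S ≤ ℓ * #valid (x ∷ S)

  -- Telescoping: the deleted elements are put back one at a time, each into a list shorter than
  -- `S`, where `Grows` is available.
  grows-many : ∀ S ys → Unique ys → ys ⊆ S → (∀ T → length T < length S → Grows T) →
    product (map β ys) * #valid (S ∖ ys) ≤ ℓ ^ length ys * #valid S
  grows-many S []       _          _    _     = ≤-refl
  grows-many S (y ∷ ys) (y∉ ∷ uys) ys⊆S grows = begin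
    β y * product (map β ys) * #valid (T ∖ ys)     ≡⟨ *-assoc (β y) _ _ ⟩
    β y * (product (map β ys) * #valid (T ∖ ys))   ≤⟨ *-monoʳ-≤ (β y) (grows-many T ys uys ys⊆T λ U U<T → grows U (<-trans U<T T<S)) ⟩
    β y * (ℓ ^ length ys * #valid T)               ≡⟨ left-comm (β y) (ℓ ^ length ys) (#valid T) ⟩
    ℓ ^ length ys * (β y * #valid T)               ≤⟨ *-monoʳ-≤ (ℓ ^ length ys) (grows T T<S y y∉T) ⟩
    -- `y ∷ T` has the members of `S`, though perhaps in another order and with fewer repetitions;
    -- antitonicity makes this harmless.
    ℓ ^ length ys * (ℓ * #valid (y ∷ T))           ≤⟨ *-monoʳ-≤ (ℓ ^ length ys) (*-monoʳ-≤ ℓ (#valid-antitone S⊆y∷T)) ⟩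
    ℓ ^ length ys * (ℓ * #valid S)                 ≡⟨ left-comm (ℓ ^ length ys) ℓ (#valid S) ⟩
    ℓ * (ℓ ^ length ys * #valid S)                 ≡⟨ *-assoc ℓ _ _ ⟨
    ℓ * ℓ ^ length ys * #valid S                   ∎
    where
    open ≤-Reasoning
    T = S - y
    ≢y? = λ s → ¬? (s ≟X y)

    left-comm : ∀ a b c → a * (b * c) ≡ b * (a * c)
    left-comm = solve-∀

    T<S : length T < length S
    T<S = filter-notAll ≢y? S (lose (ys⊆S (here refl)) (λ s≢y → s≢y refl))

    y∉T : y ∉ T
    y∉T y∈ = proj₂ (∈-filter⁻ ≢y? {xs = S} y∈) refl

    ys⊆T : ys ⊆ T
    ys⊆T x∈ = ∈-filter⁺ ≢y? (ys⊆S (there x∈)) (All.lookup y∉ x∈ ∘ sym)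

    S⊆y∷T : S ⊆ y ∷ T
    S⊆y∷T {x} x∈ with x ≟X y
    ... | yes refl = here refl
    ... | no x≢y   = there (∈-filter⁺ ≢y? x∈ x≢y)

  grows-step : ∀ S → (∀ T → length T < length S → Grows T) → Grows S
  grows-step S grows x x∉S = +-cancelˡ-≤ (ℓ * ∑ #bad (events x)) _ _ (begin
    ℓ * ∑ #bad (events x) + β x * #valid S              ≤⟨ sparse x #bad (#valid S) #bad-bound ⟩
    ℓ * #valid S                                        ≤⟨ *-monoʳ-≤ ℓ (count-union (valid? S ∘ colour) (valid? (x ∷ S) ∘ colour)
                                                              (λ ev → bad? ev ∘ colour) (events x) Ω cover) ⟩
    ℓ * (#valid (x ∷ S) + ∑ #bad (events x))            ≡⟨ cong (ℓ *_) (+-comm (#valid (x ∷ S)) _) ⟩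
    ℓ * (∑ #bad (events x) + #valid (x ∷ S))            ≡⟨ *-distribˡ-+ ℓ _ _ ⟩
    ℓ * ∑ #bad (events x) + ℓ * #valid (x ∷ S)          ∎)
    where
    open ≤-Reasoning

    -- With `Inside` as a conjunct, an event that leaves `x ∷ S` has no bad choices, and only events
    -- inside it have to be estimated.
    Bad : Event → (X → ℕ) → Set
    Bad ev c = Inside (x ∷ S) ev × Valid S c × Matched c ev

    inside? : ∀ ev → Dec (Inside (x ∷ S) ev)
    inside? ev = all? (_∈? (x ∷ S)) (support ev)

    bad? : ∀ ev c → Dec (Bad ev c)
    bad? ev c = inside? ev ×-dec valid? S c ×-dec matched? c ev

    #bad : Event → ℕ
    #bad ev = count (bad? ev ∘ colour) Ω

    cover : ∀ ω → Valid S (colour ω) → Valid (x ∷ S) (colour ω) ⊎ ∃ λ ev → ev ∈ events x × Bad ev (colour ω)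
    cover ω v with any? (λ ev → bad? ev (colour ω)) (events x)
    ... | yes bad  = inj₂ (find bad)
    ... | no  ¬bad = inj₁ (All.tabulate λ z∈ → All.tabulate λ {ev} ev∈ ins m → valid z∈ ev∈ ins m)
      where
      no-bad : ∀ {ev} → ev ∈ events x → Inside (x ∷ S) ev → ¬ Matched (colour ω) ev
      no-bad ev∈ ins m = ¬bad (lose ev∈ (ins , v , m))

      shrink : ∀ {s} {ys : List X} → x ∉ ys → s ∈ ys → s ∈ x ∷ S → s ∈ S
      shrink x∉ s∈ (here refl) = contradiction s∈ x∉
      shrink _  _  (there s∈S) = s∈S

      valid : ∀ {z ev} → z ∈ x ∷ S → ev ∈ events z → Inside (x ∷ S) ev → ¬ Matched (colour ω) ev
      valid (here refl)          ev∈ ins m = no-bad ev∈ ins m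
      -- An event listed at an older element either avoids `x`, and validity on `S` excludes it, or
      -- contains `x`, and `transfer` moves it to `x`.
      valid {ev = ev} (there z∈) ev∈ ins m with x ∈? support ev
      ... | no x∉ = All.lookup (All.lookup v z∈) ev∈
                      (All.tabulate λ s∈ → shrink x∉ s∈ (All.lookup ins s∈)) m
      ... | yes x∈ with ev′ , ev′∈ , sub , matched′ ← transfer ev∈ x∈ =
        no-bad ev′∈ (All.tabulate (All.lookup ins ∘ sub)) (matched′ _ m)

    -- Let `ys` be the first half without `x`. A bad choice is valid on `S ∖ ys`, which misses the
    -- whole first half, so `count-matched` applies there; `grows-many` then leads from `S ∖ ys`
    -- back to `S`.
    #bad-bound : ∀ {ev} → ev ∈ events x → ℓ * #bad ev * product (map β (map proj₁ ev)) ≤ β x * #valid S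
    #bad-bound {ev} ev∈ = [ bound-inside , bound-outside ]′ (toSum (inside? ev))
      where
      bound-outside : ¬ Inside (x ∷ S) ev → ℓ * #bad ev * product (map β (map proj₁ ev)) ≤ β x * #valid S
      bound-outside ¬ins = begin
        ℓ * #bad ev * product (map β (map proj₁ ev))  ≡⟨ cong (λ k → ℓ * k * product (map β (map proj₁ ev))) (count-none (bad? ev ∘ colour) Ω (λ _ → ¬ins ∘ proj₁)) ⟩
        ℓ * 0 * product (map β (map proj₁ ev))        ≡⟨ cong (_* product (map β (map proj₁ ev))) (*-zeroʳ ℓ) ⟩
        0                                             ≤⟨ z≤n ⟩
        β x * #valid S                                ∎

      bound-inside : Inside (x ∷ S) ev → ℓ * #bad ev * product (map β (map proj₁ ev)) ≤ β x * #valid S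
      bound-inside ins
        with (_ , z) , xz∈ , refl ← ∈-map⁻ proj₁ (first ev∈)
        with as , bs , eq ← ∈-∃++ xz∈ = begin
        ℓ * #bad ev * product (map β (map proj₁ ev))    ≡⟨ cong (ℓ * #bad ev *_) (product-↭ (↭-map⁺ β firsts↭)) ⟩
        ℓ * #bad ev * (β x * product (map β ys))        ≡⟨ comm₁ ℓ (#bad ev) (β x) (product (map β ys)) ⟩
        β x * (product (map β ys) * (ℓ * #bad ev))      ≤⟨ *-monoʳ-≤ (β x) (*-cancelˡ-≤ (ℓ ^ length rest) scaled) ⟩
        β x * #valid S                                  ∎
        where
        rest = as ++ bs
        ys = map proj₁ rest
        ev↭ : ev ↭ (x , z) ∷ rest
        ev↭ = subst (_↭ (x , z) ∷ rest) (sym eq) (shift (x , z) as bs)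

        firsts↭ : map proj₁ ev ↭ x ∷ ys
        firsts↭ = ↭-map⁺ proj₁ ev↭

        support↭ : support ev ↭ support ((x , z) ∷ rest)
        support↭ = ↭-++⁺ firsts↭ (↭-map⁺ proj₂ ev↭)

        u : Unique (support ((x , z) ∷ rest))
        u = Unique-resp-↭ support↭ (unique ev∈)

        u-firsts : Unique (x ∷ ys)
        u-firsts = Unique-++⁻ˡ (x ∷ ys) u

        instance
          ℓ^≢0 : NonZero (ℓ ^ length rest)
          ℓ^≢0 = m^n≢0 ℓ (length rest) {{>-nonZero ℓ-pos}}

        ys⊆S : ys ⊆ S
        ys⊆S y∈ with All.lookup ins (∈-resp-↭ (↭-sym support↭) (∈-++⁺ˡ (there y∈)))
        ... | there y∈S = y∈S
        ... | here refl with x∉ys ∷ _ ← u-firsts = contradiction refl (All.lookup x∉ys y∈)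

        firsts∉ : All (_∉ S ∖ ys) (x ∷ ys)
        firsts∉ = (x∉S ∘ proj₁ ∘ ∈-∖⁻ S ys) ∷ All.tabulate (λ y∈ y∈∖ → proj₂ (∈-∖⁻ S ys y∈∖) y∈)

        P? = λ ω → valid? (S ∖ ys) (colour ω) ×-dec matched? (colour ω) ((x , z) ∷ rest)

        comm₁ : ∀ a b c d → a * b * (c * d) ≡ c * (d * (a * b))
        comm₁ = solve-∀
        comm₂ : ∀ a b c d → a * (b * (c * d)) ≡ b * (c * a * d)
        comm₂ = solve-∀

        -- Recolouring the half gains one power of `ℓ` for each of its elements, and restoring `ys`
        -- returns all but one of them. The surplus `ℓ` belongs to `x`, which is not in `S`.
        scaled : ℓ ^ length rest * (product (map β ys) * (ℓ * #bad ev)) ≤ ℓ ^ length rest * #valid S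
        scaled = begin
          ℓ ^ length rest * (product (map β ys) * (ℓ * #bad ev))  ≡⟨ comm₂ (ℓ ^ length rest) (product (map β ys)) ℓ (#bad ev) ⟩
          product (map β ys) * (ℓ ^ suc (length rest) * #bad ev)  ≤⟨ *-monoʳ-≤ (product (map β ys)) (*-monoʳ-≤ (ℓ ^ suc (length rest))
              (count-mono (bad? ev ∘ colour) P? Ω λ ω (_ , v , m) → valid-antitone {c = colour ω} (proj₁ ∘ ∈-∖⁻ S ys) v , All-resp-↭ ev↭ m)) ⟩
          product (map β ys) * (ℓ ^ suc (length rest) * count P? Ω) ≤⟨ *-monoʳ-≤ (product (map β ys)) (count-matched (S ∖ ys) ((x , z) ∷ rest) u firsts∉) ⟩
          product (map β ys) * #valid (S ∖ ys)                    ≤⟨ grows-many S ys (AllPairs.tail u-firsts) ys⊆S grows ⟩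
          ℓ ^ length ys * #valid S                                ≡⟨ cong (λ k → ℓ ^ k * #valid S) (length-map proj₁ rest) ⟩
          ℓ ^ length rest * #valid S                              ∎

  grows-all : ∀ S → Grows S
  grows-all S = go S (<-wellFounded (length S))
    where
    go : ∀ S → Acc _<_ (length S) → Grows S
    go S (acc rs) = grows-step S λ T T<S → go T (rs T<S)

  elements : List X
  elements = map from (allFin N)

  ∈-elements : ∀ x → x ∈ elements
  ∈-elements x = subst (_∈ elements) (strictlyInverseʳ x) (∈-map⁺ from (∈-allFin (to x)))

  product-pos : ∀ ys → 0 < product (map β ys)
  product-pos []       = z<s
  product-pos (y ∷ ys) = *-mono-< (β-pos y) (product-pos ys)

  -- Nothing remains in `elements ∖ elements`, so every choice is valid there, and a choice exists
  -- because the lists are nonempty. Restoring all elements keeps the count positive, since every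
  -- weight is.
  #valid-pos : 0 < #valid elements
  #valid-pos = *-cancelˡ-< (ℓ ^ length elements) _ _ (begin-strict
    ℓ ^ length elements * 0                                          ≡⟨ *-zeroʳ (ℓ ^ length elements) ⟩
    0                                                                <⟨ *-mono-< (product-pos elements) all-pos ⟩
    product (map β elements) * #valid (elements ∖ elements)          ≤⟨ grows-many elements elements u id (λ T _ → grows-all T) ⟩
    ℓ ^ length elements * #valid elements                            ∎)
    where
    open ≤-Reasoning
    from-injective : ∀ {i j} → from i ≡ from j → i ≡ j
    from-injective {i} {j} eq = trans (sym (strictlyInverseˡ i)) (trans (cong to eq) (strictlyInverseˡ j))

    u : Unique elements
    u = Unique.map⁺ from-injective (Unique.allFin⁺ N)

    lists-nonempty : ∀ i → 0 < length (lookup lists i)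
    lists-nonempty i = ≤-trans ℓ-pos (≤-trans (L-large (from i))
      (≤-reflexive (cong length (sym (lookup∘tabulate (L ∘ from) i)))))

    all-pos : 0 < #valid (elements ∖ elements)
    all-pos = ≤-trans (choices-nonempty lists lists-nonempty) (≤-reflexive (sym
      (count-const (valid? (elements ∖ elements) ∘ colour) Ω λ ω →
        All.tabulate λ x∈ → contradiction (∈-elements _) (proj₂ (∈-∖⁻ elements elements x∈)))))

  avoiding-colouring : ∃ λ (c : X → ℕ) → (∀ x → c x ∈ L x) × (∀ {x ev} → ev ∈ events x → ¬ Matched c ev)
  avoiding-colouring = case 0<∑⇒∃ _ Ω #valid-pos of λ (ω , ω∈ , 0<𝟙) →
      colour ω
    , (λ x → subst (colour ω x ∈_) (lookup-lists x) (choices-lookup lists ω∈ (to x)))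
    , λ {x} {ev} ev∈ → All.lookup (All.lookup (𝟙-pos (valid? elements (colour ω)) 0<𝟙) (∈-elements x)) ev∈
                    (All.tabulate λ _ → ∈-elements _)

-- Numerical and list lemmas

-- geometric k · Δ ^ k is the least product of the weights 2Δ and 4Δ alternating along k elements.
geometric : ℕ → ℕ
geometric 0             = 1
geometric 1             = 2
geometric (suc (suc k)) = 8 * geometric k

sum-applyUpTo-* : ∀ c (B : ℕ → ℕ) K → sum (applyUpTo (λ k → c * B k) K) ≡ c * sum (applyUpTo B K)
sum-applyUpTo-* c B zero    = sym (*-zeroʳ c)
sum-applyUpTo-* c B (suc K) = trans (cong (c * B 0 +_) (sum-applyUpTo-* c (B ∘ suc) K))
  (sym (*-distribˡ-+ c (B 0) _))

-- Σ k / geometric k ≤ 9/8; the offset c is what removing the first two terms leaves behind.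
geometric-series : ∀ K c M (B : ℕ → ℕ) → (∀ k → geometric (suc k) * B k ≤ (suc k + c) * M) →
  8 * sum (applyUpTo B K) ≤ (9 + 6 * c) * M
geometric-series zero          c M B B≤ = z≤n
geometric-series (suc zero)    c M B B≤ = begin
  8 * (B 0 + 0)                     ≡⟨ eq₁ (B 0) ⟩
  4 * (2 * B 0)                     ≤⟨ *-monoʳ-≤ 4 (B≤ 0) ⟩
  4 * ((1 + c) * M)                 ≤⟨ m≤m+n _ (5 * M + 2 * c * M) ⟩
  4 * ((1 + c) * M) + (5 * M + 2 * c * M) ≡⟨ eq₂ c M ⟩
  (9 + 6 * c) * M                   ∎
  where
  open ≤-Reasoning
  eq₁ : ∀ b → 8 * (b + 0) ≡ 4 * (2 * b)
  eq₁ = solve-∀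
  eq₂ : ∀ c M → 4 * ((1 + c) * M) + (5 * M + 2 * c * M) ≡ (9 + 6 * c) * M
  eq₂ = solve-∀
geometric-series (suc (suc K)) c M B B≤ = *-cancelˡ-≤ 8 (begin
  8 * (8 * (B 0 + (B 1 + T)))                                    ≡⟨ eq₁ (B 0) (B 1) T ⟩
  -- Two terms are split off. In the tail `geometric` has gained a factor 8, which is moved into the
  -- sequence so that the induction hypothesis applies with offset `2 + c`.
  32 * (2 * B 0) + 8 * (8 * B 1) + 8 * (8 * T)                   ≡⟨ cong (λ t → 32 * (2 * B 0) + 8 * (8 * B 1) + 8 * t) (sum-applyUpTo-* 8 (λ k → B (2 + k)) K) ⟨
  32 * (2 * B 0) + 8 * (8 * B 1) + 8 * sum (applyUpTo (λ k → 8 * B (2 + k)) K)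
    ≤⟨ +-mono-≤ (+-mono-≤ (*-monoʳ-≤ 32 (B≤ 0)) (*-monoʳ-≤ 8 (B≤ 1))) (geometric-series K (2 + c) M (λ k → 8 * B (2 + k)) shifted) ⟩
  -- The coefficient of `M` is 69 + 46c, against the allowed 72 + 48c; the added summand is the
  -- difference.
  32 * ((1 + c) * M) + 8 * ((2 + c) * M) + (9 + 6 * (2 + c)) * M ≤⟨ m≤m+n _ (3 * M + 2 * c * M) ⟩
  32 * ((1 + c) * M) + 8 * ((2 + c) * M) + (9 + 6 * (2 + c)) * M + (3 * M + 2 * c * M) ≡⟨ eq₂ c M ⟩
  8 * ((9 + 6 * c) * M)                                          ∎)
  where
  open ≤-Reasoning
  T = sum (applyUpTo (λ k → B (2 + k)) K)
  eq₁ : ∀ a b t → 8 * (8 * (a + (b + t))) ≡ 32 * (2 * a) + 8 * (8 * b) + 8 * (8 * t)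
  eq₁ = solve-∀
  eq₂ : ∀ c M → 32 * ((1 + c) * M) + 8 * ((2 + c) * M) + (9 + 6 * (2 + c)) * M + (3 * M + 2 * c * M) ≡ 8 * ((9 + 6 * c) * M)
  eq₂ = solve-∀
  shifted : ∀ k → geometric (suc k) * (8 * B (2 + k)) ≤ (suc k + (2 + c)) * M
  shifted k = begin
    geometric (suc k) * (8 * B (2 + k))   ≡⟨ eq₃ (geometric (suc k)) (B (2 + k)) ⟩
    8 * geometric (suc k) * B (2 + k)     ≤⟨ B≤ (2 + k) ⟩
    (suc (2 + k) + c) * M                 ≡⟨ cong (_* M) (eq₄ k c) ⟩
    (suc k + (2 + c)) * M                 ∎
    where
    eq₃ : ∀ g b → g * (8 * b) ≡ 8 * g * b
    eq₃ = solve-∀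
    eq₄ : ∀ k c → suc (2 + k) + c ≡ suc k + (2 + c)
    eq₄ = solve-∀

-- An odd sum means that exactly one of `i` and `j` is odd, so rounding changes the total by one
-- half in all.
halves-odd : ∀ i j k → i + j ≡ suc (k + k) → ⌊ i /2⌋ + ⌊ j /2⌋ ≡ k × ⌈ i /2⌉ + ⌈ j /2⌉ ≡ suc k
halves-odd 0 _ k refl = sym (n≡⌈n+n/2⌉ k) , cong suc (sym (n≡⌊n+n/2⌋ k))
halves-odd 1 j k eq with refl ← suc-injective eq = sym (n≡⌊n+n/2⌋ k) , cong suc (sym (n≡⌈n+n/2⌉ k))
halves-odd (suc (suc i)) j (suc k) eq
  with f , c ← halves-odd i j k (trans (suc-injective (suc-injective eq)) (+-suc k k)) = cong suc f , cong suc c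
halves-odd (suc (suc i)) j zero eq with () ← suc-injective eq

module _ {A B : Set} where

  length-concatMap-≤ : ∀ (f : A → List B) {c} xs → (∀ {x} → x ∈ xs → length (f x) ≤ c) → length (concatMap f xs) ≤ length xs * c
  length-concatMap-≤ f []       _   = z≤n
  length-concatMap-≤ f (x ∷ xs) f≤c = ≤-trans (≤-reflexive (length-++ (f x)))
    (+-mono-≤ (f≤c (here refl)) (length-concatMap-≤ f xs (f≤c ∘ there)))

  length-cartesianProduct : ∀ (xs : List A) (ys : List B) → length (cartesianProduct xs ys) ≡ length xs * length ys
  length-cartesianProduct []       ys = refl
  length-cartesianProduct (x ∷ xs) ys = trans (length-++ (map (x ,_) ys))
    (cong₂ _+_ (length-map (x ,_) ys) (length-cartesianProduct xs ys))

  map-proj₁-zip : ∀ (xs : List A) (ys : List B) → length xs ≡ length ys → map proj₁ (zip xs ys) ≡ xs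
  map-proj₁-zip []       []       _  = refl
  map-proj₁-zip (x ∷ xs) (y ∷ ys) eq = cong (x ∷_) (map-proj₁-zip xs ys (suc-injective eq))

  map-proj₂-zip : ∀ (xs : List A) (ys : List B) → length xs ≡ length ys → map proj₂ (zip xs ys) ≡ ys
  map-proj₂-zip []       []       _  = refl
  map-proj₂-zip (x ∷ xs) (y ∷ ys) eq = cong (y ∷_) (map-proj₂-zip xs ys (suc-injective eq))

  -- Serves to pull a factorisation of a colour sequence back to the path that carries it.
  map-++⁻ : ∀ (f : A → B) xs as {bs} → map f xs ≡ as ++ bs →
    ∃₂ λ ys zs → xs ≡ ys ++ zs × map f ys ≡ as × map f zs ≡ bs
  map-++⁻ f xs       []       eq = [] , xs , refl , refl , eq
  map-++⁻ f (x ∷ xs) (a ∷ as) eq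
    with ys , zs , refl , ys≡ , zs≡ ← map-++⁻ f xs as (∷-injectiveʳ eq) =
    x ∷ ys , zs , refl , cong₂ _∷_ (∷-injectiveˡ eq) ys≡ , zs≡

module _ {A : Set} where

  take-length-++ : ∀ (xs ys : List A) → take (length xs) (xs ++ ys) ≡ xs
  take-length-++ []       ys = refl
  take-length-++ (x ∷ xs) ys = cong (x ∷_) (take-length-++ xs ys)

  drop-length-++ : ∀ (xs ys : List A) → drop (length xs) (xs ++ ys) ≡ ys
  drop-length-++ []       ys = refl
  drop-length-++ (x ∷ xs) ys = drop-length-++ xs ys

  Unique-lookup-injective : ∀ {xs : List A} → Unique xs → ∀ {i j} → List.lookup xs i ≡ List.lookup xs j → i ≡ j
  Unique-lookup-injective (_  ∷ _) {zero}  {zero}  _  = refl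
  Unique-lookup-injective (x∉ ∷ _) {zero}  {suc j} eq = contradiction eq (All.lookup x∉ (∈-lookup j))
  Unique-lookup-injective (x∉ ∷ _) {suc i} {zero}  eq = contradiction (sym eq) (All.lookup x∉ (∈-lookup i))
  Unique-lookup-injective (_  ∷ u) {suc i} {suc j} eq = cong suc (Unique-lookup-injective u eq)

  Unique-++⁻ʳ : ∀ (xs : List A) {ys} → Unique (xs ++ ys) → Unique ys
  Unique-++⁻ʳ []       u       = u
  Unique-++⁻ʳ (x ∷ xs) (_ ∷ u) = Unique-++⁻ʳ xs u

  module _ {R : A → A → Set} where

    Linked-++⁻ˡ : ∀ xs {ys} → Linked R (xs ++ ys) → Linked R xs
    Linked-++⁻ˡ []           _       = []
    Linked-++⁻ˡ (x ∷ [])     _       = [-]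
    Linked-++⁻ˡ (x ∷ y ∷ xs) (r ∷ l) = r ∷ Linked-++⁻ˡ (y ∷ xs) l

    Linked-++⁻ʳ : ∀ xs {ys} → Linked R (xs ++ ys) → Linked R ys
    Linked-++⁻ʳ []       l = l
    Linked-++⁻ʳ (x ∷ xs) l = Linked-++⁻ʳ xs (Linked.tail l)

    Linked-ʳ++ : Symmetric R → ∀ {x xs ys} → Linked R (x ∷ xs) → Linked R (x ∷ ys) → Linked R (xs ʳ++ x ∷ ys)
    Linked-ʳ++ R-sym [-]     l′ = l′
    Linked-ʳ++ R-sym (r ∷ l) l′ = Linked-ʳ++ R-sym l (R-sym r ∷ l′)

    Linked-reverse : Symmetric R → ∀ {xs} → Linked R xs → Linked R (reverse xs)
    Linked-reverse R-sym {[]}     _ = []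
    Linked-reverse R-sym {x ∷ xs} l = Linked-ʳ++ R-sym l [-]

module _ {X : Set} (c : X → ℕ) where

  matched⇒map≡ : ∀ {ev} → Matched c ev → map c (map proj₁ ev) ≡ map c (map proj₂ ev)
  matched⇒map≡ []       = refl
  matched⇒map≡ (eq ∷ m) = cong₂ _∷_ eq (matched⇒map≡ m)

  map≡⇒matched : ∀ xs ys → map c xs ≡ map c ys → Matched c (zip xs ys)
  map≡⇒matched []       _        _  = []
  map≡⇒matched (x ∷ xs) (y ∷ ys) eq = ∷-injectiveˡ eq ∷ map≡⇒matched xs ys (∷-injectiveʳ eq)

-- Squares on mixed paths

module _ (G : Graph) where

  mixed-++⁻ˡ : ∀ P {Q} → MixedPath G (P ++ Q) → MixedPath G P
  mixed-++⁻ˡ P (l , u) = Linked-++⁻ˡ P l , Unique-++⁻ˡ P u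

  mixed-++⁻ʳ : ∀ P {Q} → MixedPath G (P ++ Q) → MixedPath G Q
  mixed-++⁻ʳ P (l , u) = Linked-++⁻ʳ P l , Unique-++⁻ʳ P u

  incident-sym : Symmetric (Incident G)
  incident-sym {inj₁ _} {inj₂ _} inc = inc
  incident-sym {inj₂ _} {inj₁ _} inc = inc

  mixed-reverse : ∀ {P} → MixedPath G P → MixedPath G (reverse P)
  mixed-reverse {P} (l , u) = Linked-reverse incident-sym l , Unique-resp-↭ (↭-sym (↭-reverse P)) u

  endOf? : ∀ v e → Dec (EndOf G v e)
  endOf? v e = (v Fin.≟ proj₁ (ends G e)) ⊎-dec (v Fin.≟ proj₂ (ends G e))

  incident? : ∀ x y → Dec (Incident G x y)
  incident? (inj₁ _) (inj₁ _) = no λ ()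
  incident? (inj₁ v) (inj₂ e) = endOf? v e
  incident? (inj₂ e) (inj₁ v) = endOf? v e
  incident? (inj₂ _) (inj₂ _) = no λ ()

  _≟E_ : (x y : Element G) → Dec (x ≡ y)
  _≟E_ = Sum.≡-dec Fin._≟_ Fin._≟_

  mixed? : ∀ P → Dec (MixedPath G P)
  mixed? P = linked? incident? P ×-dec allPairs? (λ x y → ¬? (x ≟E y)) P

  elementsIndex : Element G ↔ Fin (n G + m G)
  elementsIndex = ↔-sym Fin.+↔⊎

  -- Pigeonhole: the elements of a mixed path are distinct, so its positions inject into the finite
  -- index set of all elements. This bounds the half-lengths to be considered.
  mixed-length : ∀ {P} → MixedPath G P → length P ≤ n G + m G
  mixed-length {P} (_ , u) = Fin.injective⇒≤ {f = to ∘ List.lookup P} λ eq →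
    Unique-lookup-injective u (trans (sym (strictlyInverseʳ _)) (trans (cong from eq) (strictlyInverseʳ _)))
    where open Inverse elementsIndex

  -- Enumeration of mixed paths through an element

  incidentEdges : Vertex G → List (Edge G)
  incidentEdges v = filter (endOf? v) (allFin (m G))

  -- Total for convenience: the value at a vertex that is not an end of the edge is a mere default.
  opposite : Edge G → Vertex G → Vertex G
  opposite e v = if does (v Fin.≟ proj₁ (ends G e)) then proj₂ (ends G e) else proj₁ (ends G e)

  opposite≡ : ∀ {e v u} → EndOf G v e → EndOf G u e → v ≢ u → opposite e v ≡ u
  opposite≡ {e} {v} v∈e u∈e v≢u with v Fin.≟ proj₁ (ends G e) | v∈e | u∈e
  ... | yes v≡ | _       | inj₁ u≡ = contradiction (trans v≡ (sym u≡)) v≢u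
  ... | yes _  | _       | inj₂ u≡ = sym u≡
  ... | no  v≢ | inj₁ v≡ | _       = contradiction v≡ v≢
  ... | no  _  | inj₂ _  | inj₁ u≡ = sym u≡
  ... | no  _  | inj₂ v≡ | inj₂ u≡ = contradiction (trans v≡ (sym u≡)) v≢u

  -- walksFrom j v lists continuations with j elements of a mixed path that ends in v;
  -- walksInto j u those of a mixed path that ends in an edge and must go on to u.
  mutual
    walksFrom : ℕ → Vertex G → List (List (Element G))
    walksFrom zero    v = [ [] ]
    walksFrom (suc j) v = concatMap (λ e → map (inj₂ e ∷_) (walksInto j (opposite e v))) (incidentEdges v)

    walksInto : ℕ → Vertex G → List (List (Element G))
    walksInto zero    u = [ [] ]
    walksInto (suc j) u = map (inj₁ u ∷_) (walksFrom j u)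

  -- Distinctness enters only to show that the vertex after an edge differs from the one before,
  -- hence is `opposite`. The enumeration also contains walks that repeat elements, which an upper
  -- bound can afford.
  walksFrom-complete : ∀ v w → MixedPath G (inj₁ v ∷ w) → w ∈ walksFrom (length w) v
  walksFrom-complete v [] _ = here refl
  walksFrom-complete v (inj₁ _ ∷ w) (() ∷ _ , _)
  walksFrom-complete v (inj₂ e ∷ w) (v∈e ∷ l , v∉ ∷ u) =
    ∈-concatMap⁺ (λ e′ → map (inj₂ e′ ∷_) (walksInto (length w) (opposite e′ v))) (lose (∈-filter⁺ (endOf? v) (∈-allFin e) v∈e) (∈-map⁺ (inj₂ e ∷_) (onward w l v∉ u)))
    where
    onward : ∀ w → Linked (Incident G) (inj₂ e ∷ w) → All (inj₁ v ≢_) (inj₂ e ∷ w) → Unique (inj₂ e ∷ w) →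
      w ∈ walksInto (length w) (opposite e v)
    onward []            _         _              _       = here refl
    onward (inj₂ _ ∷ _)  (() ∷ _)  _              _
    onward (inj₁ u ∷ w) (u∈e ∷ l) (_ ∷ v≢u ∷ _) (_ ∷ uw)
      rewrite opposite≡ v∈e u∈e (v≢u ∘ cong inj₁) = ∈-map⁺ (inj₁ u ∷_) (walksFrom-complete u w (l , uw))

  -- The membership of `inj₁ u` in `w` is recorded so that two disjoint arms at an edge can be seen
  -- to leave through different ends.
  walksInto-complete : ∀ e w → MixedPath G (inj₂ e ∷ w) →
    w ≡ [] ⊎ ∃ λ u → EndOf G u e × inj₁ u ∈ w × w ∈ walksInto (length w) u
  walksInto-complete e []           _ = inj₁ refl
  walksInto-complete e (inj₁ u ∷ w) (u∈e ∷ l , _ ∷ uw) =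
    inj₂ (u , u∈e , here refl , ∈-map⁺ (inj₁ u ∷_) (walksFrom-complete u w (l , uw)))
  walksInto-complete e (inj₂ _ ∷ w) (() ∷ _ , _)

  -- arms x i j lists the pairs (l , r) for which reverse l ++ x ∷ r may be a mixed path,
  -- with l and r of lengths i and j.
  arms : Element G → ℕ → ℕ → List (List (Element G) × List (Element G))
  arms (inj₁ v) i j = cartesianProduct (walksFrom i v) (walksFrom j v)
  arms (inj₂ e) i j = cartesianProduct (walksInto i a) (walksInto j b)
                   ++ cartesianProduct (walksInto i b) (walksInto j a)
    where
    a = proj₁ (ends G e)
    b = proj₂ (ends G e)

  -- Reversing the part up to `x` makes both arms continuations of a path that starts at `x`, and
  -- distinctness of the whole path makes the arms disjoint.
  arms-complete : ∀ x l r → MixedPath G (reverse l ++ x ∷ r) → (l , r) ∈ arms x (length l) (length r)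
  arms-complete x l r P = complete x left right disjoint
    where
    left : MixedPath G (x ∷ l)
    left = subst (MixedPath G) (trans (reverse-++ (reverse l) [ x ]) (cong (x ∷_) (reverse-involutive l)))
      (mixed-reverse (mixed-++⁻ˡ (reverse l ++ [ x ]) (subst (MixedPath G) (sym (++-assoc (reverse l) [ x ] r)) P)))

    right : MixedPath G (x ∷ r)
    right = mixed-++⁻ʳ (reverse l) P

    disjoint : ∀ {y} → y ∈ l → y ∉ r
    disjoint {y} y∈l y∈r = AllPairs-++⁻ (reverse l) (proj₂ P) (Any.reverse⁺ y∈l) (there y∈r)
      where
      AllPairs-++⁻ : ∀ xs {ys} → Unique (xs ++ ys) → y ∈ xs → y ∉ ys
      AllPairs-++⁻ (x ∷ xs) (x∉ ∷ _) (here refl) y∈ = All.lookup x∉ (∈-++⁺ʳ xs y∈) refl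
      AllPairs-++⁻ (x ∷ xs) (_ ∷ u)  (there y∈′) y∈ = AllPairs-++⁻ xs u y∈′ y∈

    complete : ∀ x → MixedPath G (x ∷ l) → MixedPath G (x ∷ r) → (∀ {y} → y ∈ l → y ∉ r) →
      (l , r) ∈ arms x (length l) (length r)
    complete (inj₁ v) left right _ = ∈-cartesianProduct⁺ (walksFrom-complete v l left) (walksFrom-complete v r right)
    complete (inj₂ e) left right disj with walksInto-complete e l left | walksInto-complete e r right
    -- An empty arm suits either end, so a nonempty arm decides which of the two products contains
    -- the pair.
    ... | inj₁ refl | inj₁ refl = here refl
    ... | inj₁ refl | inj₂ (u , inj₁ refl , _ , r∈) =
      ∈-++⁺ʳ (cartesianProduct [ [] ] (walksInto (length r) _)) (∈-cartesianProduct⁺ {xs = [ [] ]} (here refl) r∈)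
    ... | inj₁ refl | inj₂ (u , inj₂ refl , _ , r∈) = ∈-++⁺ˡ (∈-cartesianProduct⁺ {xs = [ [] ]} (here refl) r∈)
    ... | inj₂ (u , inj₁ refl , _ , l∈) | inj₁ refl = ∈-++⁺ˡ (∈-cartesianProduct⁺ l∈ (here refl))
    ... | inj₂ (u , inj₂ refl , _ , l∈) | inj₁ refl =
      ∈-++⁺ʳ (cartesianProduct (walksInto (length l) _) [ [] ]) (∈-cartesianProduct⁺ l∈ (here refl))
    ... | inj₂ (_ , inj₁ refl , _ , l∈) | inj₂ (_ , inj₂ refl , _ , r∈) = ∈-++⁺ˡ (∈-cartesianProduct⁺ l∈ r∈)
    ... | inj₂ (_ , inj₂ refl , _ , l∈) | inj₂ (_ , inj₁ refl , _ , r∈) =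
      ∈-++⁺ʳ (cartesianProduct (walksInto (length l) _) (walksInto (length r) _)) (∈-cartesianProduct⁺ l∈ r∈)
    -- Arms that leave through the same end would share that vertex.
    ... | inj₂ (_ , inj₁ refl , u∈l , _) | inj₂ (_ , inj₁ refl , u∈r , _) = contradiction u∈r (disj u∈l)
    ... | inj₂ (_ , inj₂ refl , u∈l , _) | inj₂ (_ , inj₂ refl , u∈r , _) = contradiction u∈r (disj u∈l)

  -- Squares with a given element in the first half

  halve : Element G → ℕ → List (Element G) × List (Element G) → Event
  halve x k (l , r) = zip (take k P) (drop k P)
    where P = reverse l ++ x ∷ r

  -- Discards the surplus of the enumeration: after filtering by it, every event has a mixed path as
  -- support, with `x` in its first half.
  HalvedAt : Element G → ℕ → Event → Set
  HalvedAt x k ev = length ev ≡ k × MixedPath G (support ev) × x ∈ map proj₁ ev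

  halvedAt? : ∀ x k ev → Dec (HalvedAt x k ev)
  halvedAt? x k ev = (length ev ≟ k) ×-dec mixed? (support ev) ×-dec any? (x ≟E_) (map proj₁ ev)

  -- The half-length is `suc k`, and `i` elements precede `x`. Of the `2 * suc k` elements of the
  -- path, `suc (k + k) ∸ i` follow it; `x` is in the first half exactly for `i` up to `k`.
  halvingsAt : Element G → ℕ → ℕ → List Event
  halvingsAt x k i = map (halve x (suc k)) (arms x i (suc (k + k) ∸ i))

  halvings : Element G → ℕ → List Event
  halvings x k = concatMap (halvingsAt x k) (upTo (suc k))

  squares : Element G → ℕ → List Event
  squares x k = filter (halvedAt? x (suc k)) (halvings x k)

  allSquares : Element G → List Event
  allSquares x = concatMap (squares x) (upTo (n G + m G))

  allSquares-sound : ∀ x {ev} → ev ∈ allSquares x → MixedPath G (support ev) × x ∈ map proj₁ ev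
  allSquares-sound x ev∈ with k , _ , ev∈k ← find (∈-concatMap⁻ (squares x) {xs = upTo (n G + m G)} ev∈) =
    proj₂ (proj₂ (∈-filter⁻ (halvedAt? x (suc k)) {xs = halvings x k} ev∈k))

  support-zip : ∀ (Y Z : List (Element G)) → length Y ≡ length Z → support (zip Y Z) ≡ Y ++ Z
  support-zip Y Z eq = cong₂ _++_ (map-proj₁-zip Y Z eq) (map-proj₂-zip Y Z eq)

  -- Splitting `Y` at `x` as `as ++ x ∷ bs` gives the arms `reverse as` and `bs ++ Z`, from which
  -- `halve` rebuilds the square.
  allSquares-complete : ∀ {x Y Z} → MixedPath G (Y ++ Z) → length Y ≡ length Z → x ∈ Y → zip Y Z ∈ allSquares x
  allSquares-complete {x} {Y} {Z} P eq x∈ with as , bs , refl ← ∈-∃++ x∈ =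
    ∈-concatMap⁺ (squares x) (lose (∈-upTo⁺ k<) (∈-filter⁺ (halvedAt? x (suc k))
      (∈-concatMap⁺ (halvingsAt x k) (lose (∈-upTo⁺ i<) (subst (_∈ halvingsAt x k i) halve≡ (∈-map⁺ (halve x (suc k)) arms∈))))
      halvedAt))
    where
    i = length as
    k = i + length bs
    r = bs ++ Z

    Y-length : length (as ++ x ∷ bs) ≡ suc k
    Y-length = trans (length-++ as) (+-suc i (length bs))

    k< : k < n G + m G
    k< = subst (_≤ n G + m G) Y-length (mixed-length (mixed-++⁻ˡ Y P))

    i< : i < suc k
    i< = s≤s (m≤m+n i (length bs))

    r-length : length r ≡ suc (k + k) ∸ i
    r-length = begin
      length (bs ++ Z)                    ≡⟨ length-++ bs ⟩
      length bs + length Z                ≡⟨ cong (length bs +_) (trans (sym eq) Y-length) ⟩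
      length bs + suc k                   ≡⟨ m+n∸m≡n i (length bs + suc k) ⟨
      i + (length bs + suc k) ∸ i         ≡⟨ cong (_∸ i) (rearrange i (length bs)) ⟩
      suc (k + k) ∸ i                     ∎
      where
      open ≡-Reasoning
      rearrange : ∀ i b → i + (b + suc (i + b)) ≡ suc (i + b + (i + b))
      rearrange = solve-∀

    whole : reverse (reverse as) ++ x ∷ r ≡ Y ++ Z
    whole = trans (cong (_++ x ∷ r) (reverse-involutive as)) (sym (++-assoc as (x ∷ bs) Z))

    arms∈ : (reverse as , r) ∈ arms x i (suc (k + k) ∸ i)
    arms∈ = subst₂ (λ p q → (reverse as , r) ∈ arms x p q) (length-reverse as) r-length
      (arms-complete x (reverse as) r (subst (MixedPath G) (sym whole) P))

    halve≡ : halve x (suc k) (reverse as , r) ≡ zip Y Z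
    halve≡ rewrite whole | sym Y-length = cong₂ zip (take-length-++ Y Z) (drop-length-++ Y Z)

    halvedAt : HalvedAt x (suc k) (zip Y Z)
    halvedAt = trans (sym (length-map proj₁ (zip Y Z))) (trans (cong length (map-proj₁-zip Y Z eq)) Y-length)
             , subst (MixedPath G) (sym (support-zip Y Z eq)) P
             , subst (x ∈_) (sym (map-proj₁-zip Y Z eq)) x∈

  -- A square whose second half contains x is read backwards.
  allSquares-transfer : ∀ {x z ev} → ev ∈ allSquares z → x ∈ support ev →
    ∃ λ ev′ → ev′ ∈ allSquares x × support ev′ ⊆ support ev × (∀ c → Matched c ev → Matched c ev′)
  allSquares-transfer {x} {z} {ev} ev∈ x∈ with P , _ ← allSquares-sound z ev∈ | ∈-++⁻ (map proj₁ ev) x∈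
  ... | inj₁ x∈Y = zip Y Z , allSquares-complete P eq x∈Y
                 , (λ y∈ → subst (_ ∈_) (support-zip Y Z eq) y∈)
                 , λ c mat → map≡⇒matched c Y Z (matched⇒map≡ c mat)
    where
    Y = map proj₁ ev
    Z = map proj₂ ev
    eq = trans (length-map proj₁ ev) (sym (length-map proj₂ ev))
  ... | inj₂ x∈Z = zip (reverse Z) (reverse Y)
                 , allSquares-complete (subst (MixedPath G) (reverse-++ Y Z) (mixed-reverse P)) eqʳ (Any.reverse⁺ x∈Z)
                 , (λ y∈ → Any.reverse⁻ (subst (_ ∈_) (trans (support-zip (reverse Z) (reverse Y) eqʳ) (sym (reverse-++ Y Z))) y∈))
                 , λ c mat → map≡⇒matched c (reverse Z) (reverse Y)
                     (trans (reverse-map c Z) (trans (cong reverse (sym (matched⇒map≡ c mat))) (sym (reverse-map c Y))))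
    where
    Y = map proj₁ ev
    Z = map proj₂ ev
    eqʳ : length (reverse Z) ≡ length (reverse Y)
    eqʳ = trans (length-reverse Z) (trans (trans (length-map proj₂ ev) (sym (length-map proj₁ ev))) (sym (length-reverse Y)))

  -- Weights and the sparsity inequality

  module _ (Δ : ℕ) where

    weight : Element G → ℕ
    weight (inj₁ _) = 2 * Δ
    weight (inj₂ _) = 4 * Δ

    2Δ≤weight : ∀ x → 2 * Δ ≤ weight x
    2Δ≤weight (inj₁ _) = ≤-refl
    2Δ≤weight (inj₂ _) = *-monoˡ-≤ Δ {2} {4} (s≤s (s≤s z≤n))

    weight-adjacent : ∀ x y → Incident G x y → weight x * weight y ≡ 8 * (Δ * Δ)
    weight-adjacent (inj₁ _) (inj₂ _) _ = eq Δ
      where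
      eq : ∀ Δ → 2 * Δ * (4 * Δ) ≡ 8 * (Δ * Δ)
      eq = solve-∀
    weight-adjacent (inj₂ _) (inj₁ _) _ = eq Δ
      where
      eq : ∀ Δ → 4 * Δ * (2 * Δ) ≡ 8 * (Δ * Δ)
      eq = solve-∀

    -- Elements are taken off in consecutive pairs, each a vertex and an edge with weights of
    -- product `8 * (Δ * Δ)`. A single leftover has weight at least `2 * Δ`.
    weight-product : ∀ {P} → Linked (Incident G) P → geometric (length P) * Δ ^ length P ≤ product (map weight P)
    weight-product []              = ≤-refl
    weight-product {x ∷ []} [-]    = begin
      2 * (Δ * 1)    ≡⟨ cong (2 *_) (*-identityʳ Δ) ⟩
      2 * Δ          ≤⟨ 2Δ≤weight x ⟩
      weight x       ≡⟨ *-identityʳ (weight x) ⟨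
      weight x * 1   ∎
      where open ≤-Reasoning
    weight-product {x ∷ y ∷ P} (r ∷ l) = begin
      8 * g * (Δ * (Δ * d))                            ≡⟨ eq g Δ d ⟩
      8 * (Δ * Δ) * (g * d)                            ≤⟨ *-monoʳ-≤ (8 * (Δ * Δ)) (weight-product (Linked.tail l)) ⟩
      8 * (Δ * Δ) * product (map weight P)             ≡⟨ cong (_* product (map weight P)) (weight-adjacent x y r) ⟨
      weight x * weight y * product (map weight P)     ≡⟨ *-assoc (weight x) (weight y) _ ⟩
      weight x * (weight y * product (map weight P))   ∎
      where
      open ≤-Reasoning
      g = geometric (length P)
      d = Δ ^ length P
      eq : ∀ g Δ d → 8 * g * (Δ * (Δ * d)) ≡ 8 * (Δ * Δ) * (g * d)
      eq = solve-∀

    -- Bounds the pairs of arms for half-length `suc k` and one fixed position of the element. The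
    -- factor 2 for an edge counts its two orientations.
    armsBound : Element G → ℕ → ℕ
    armsBound (inj₁ _) k = Δ ^ suc k
    armsBound (inj₂ _) k = 2 * Δ ^ k

    -- What is left of `armsBound x k * weight x` after division by `Δ ^ suc k`. It does not depend
    -- on `k`, so it factors out of the sum over half-lengths.
    load : Element G → ℕ
    load (inj₁ _) = 2 * Δ
    load (inj₂ _) = 8

    armsBound-weight : ∀ x k → armsBound x k * weight x ≡ Δ ^ suc k * load x
    armsBound-weight (inj₁ _) k = refl
    armsBound-weight (inj₂ _) k = eq Δ (Δ ^ k)
      where
      eq : ∀ Δ d → 2 * d * (4 * Δ) ≡ Δ * d * 8
      eq = solve-∀

    module _ (degree≤ : ∀ v → degree G v ≤ Δ) where

      mutual
        -- Only the choice of an edge branches, in at most `Δ` ways. Among `j` alternating elements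
        -- that start with an edge, `⌈ j /2⌉` are edges; if they start with a vertex, `⌊ j /2⌋` are.
        walksFrom-length : ∀ j v → length (walksFrom j v) ≤ Δ ^ ⌈ j /2⌉
        walksFrom-length zero    v = ≤-refl
        walksFrom-length (suc j) v = ≤-trans
          (length-concatMap-≤ (λ e → map (inj₂ e ∷_) (walksInto j (opposite e v))) (incidentEdges v) λ {e} _ →
            ≤-trans (≤-reflexive (length-map (inj₂ e ∷_) (walksInto j (opposite e v)))) (walksInto-length j (opposite e v)))
          -- By definition, `degree G v` is the length of `incidentEdges v`.
          (*-monoˡ-≤ (Δ ^ ⌊ j /2⌋) (degree≤ v))

        walksInto-length : ∀ j u → length (walksInto j u) ≤ Δ ^ ⌊ j /2⌋
        walksInto-length zero    u = ≤-refl
        walksInto-length (suc j) u = ≤-trans (≤-reflexive (length-map (inj₁ u ∷_) (walksFrom j u))) (walksFrom-length j u)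

      arms-length : ∀ x i j k → i + j ≡ suc (k + k) → length (arms x i j) ≤ armsBound x k
      arms-length (inj₁ v) i j k eq = begin
        length (cartesianProduct (walksFrom i v) (walksFrom j v))  ≡⟨ length-cartesianProduct (walksFrom i v) _ ⟩
        length (walksFrom i v) * length (walksFrom j v)            ≤⟨ *-mono-≤ (walksFrom-length i v) (walksFrom-length j v) ⟩
        Δ ^ ⌈ i /2⌉ * Δ ^ ⌈ j /2⌉                                  ≡⟨ ^-distribˡ-+-* Δ ⌈ i /2⌉ ⌈ j /2⌉ ⟨
        Δ ^ (⌈ i /2⌉ + ⌈ j /2⌉)                                    ≡⟨ cong (Δ ^_) (proj₂ (halves-odd i j k eq)) ⟩
        Δ ^ suc k                                                  ∎
        where open ≤-Reasoning
      arms-length (inj₂ e) i j k eq = begin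
        length (arms (inj₂ e) i j)             ≡⟨ length-++ (cartesianProduct (walksInto i a) (walksInto j b)) ⟩
        length (cartesianProduct (walksInto i a) (walksInto j b)) + length (cartesianProduct (walksInto i b) (walksInto j a))
                                               ≤⟨ +-mono-≤ (pair a b) (pair b a) ⟩
        Δ ^ k + Δ ^ k                          ≡⟨ cong (Δ ^ k +_) (+-identityʳ (Δ ^ k)) ⟨
        2 * Δ ^ k                              ∎
        where
        open ≤-Reasoning
        a = proj₁ (ends G e)
        b = proj₂ (ends G e)
        pair : ∀ u w → length (cartesianProduct (walksInto i u) (walksInto j w)) ≤ Δ ^ k
        pair u w = begin
          length (cartesianProduct (walksInto i u) (walksInto j w))  ≡⟨ length-cartesianProduct (walksInto i u) _ ⟩
          length (walksInto i u) * length (walksInto j w)            ≤⟨ *-mono-≤ (walksInto-length i u) (walksInto-length j w) ⟩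
          Δ ^ ⌊ i /2⌋ * Δ ^ ⌊ j /2⌋                                  ≡⟨ ^-distribˡ-+-* Δ ⌊ i /2⌋ ⌊ j /2⌋ ⟨
          Δ ^ (⌊ i /2⌋ + ⌊ j /2⌋)                                    ≡⟨ cong (Δ ^_) (proj₁ (halves-odd i j k eq)) ⟩
          Δ ^ k                                                      ∎

      squares-length : ∀ x k → length (squares x k) ≤ suc k * armsBound x k
      squares-length x k = begin
        length (squares x k)                   ≤⟨ length-filter (halvedAt? x (suc k)) (halvings x k) ⟩
        length (halvings x k)                  ≤⟨ length-concatMap-≤ (halvingsAt x k) (upTo (suc k)) arms≤ ⟩
        length (upTo (suc k)) * armsBound x k  ≡⟨ cong (_* armsBound x k) (length-upTo (suc k)) ⟩
        suc k * armsBound x k                  ∎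
        where
        open ≤-Reasoning
        arms≤ : ∀ {i} → i ∈ upTo (suc k) → length (halvingsAt x k i) ≤ armsBound x k
        -- Since `i` is at most `k`, the subtraction is not truncated and the arm lengths add up to
        -- `suc (k + k)`.
        arms≤ {i} i∈ = ≤-trans (≤-reflexive (length-map (halve x (suc k)) (arms x i (suc (k + k) ∸ i))))
          (arms-length x i (suc (k + k) ∸ i) k (m+[n∸m]≡n (≤-trans (<⇒≤ (∈-upTo⁻ i∈)) (s≤s (m≤m+n k k)))))

      module _ {ℓ : ℕ} (Δ≥36 : 36 ≤ Δ) (ℓ-large : 17 * Δ ≤ 4 * ℓ) where

        -- The factor 9/8 bounds the geometric sum. For a vertex the left side is exactly 34Δ, which
        -- is where 17/4 comes from; for an edge it is 72 + 32Δ, at most 34Δ because `36 ≤ Δ`.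
        load-weight : ∀ x → 9 * load x + 8 * weight x ≤ 8 * ℓ
        load-weight (inj₁ _) = begin
          9 * (2 * Δ) + 8 * (2 * Δ)    ≡⟨ eq Δ ⟩
          2 * (17 * Δ)                 ≤⟨ *-monoʳ-≤ 2 ℓ-large ⟩
          2 * (4 * ℓ)                  ≡⟨ *-assoc 2 4 ℓ ⟨
          8 * ℓ                        ∎
          where
          open ≤-Reasoning
          eq : ∀ Δ → 9 * (2 * Δ) + 8 * (2 * Δ) ≡ 2 * (17 * Δ)
          eq = solve-∀
        load-weight (inj₂ _) = begin
          2 * 36 + 8 * (4 * Δ)         ≤⟨ +-monoˡ-≤ (8 * (4 * Δ)) (*-monoʳ-≤ 2 Δ≥36) ⟩
          2 * Δ + 8 * (4 * Δ)          ≡⟨ eq Δ ⟩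
          2 * (17 * Δ)                 ≤⟨ *-monoʳ-≤ 2 ℓ-large ⟩
          2 * (4 * ℓ)                  ≡⟨ *-assoc 2 4 ℓ ⟨
          8 * ℓ                        ∎
          where
          open ≤-Reasoning
          eq : ∀ Δ → 2 * Δ + 8 * (4 * Δ) ≡ 2 * (17 * Δ)
          eq = solve-∀

        -- Events are grouped by half-length. `weight-product` bounds each term and `squares-length`
        -- their number; after cancelling `Δ ^ suc k` the groups satisfy the hypothesis of
        -- `geometric-series`. The factor 8 clears the denominator of 9/8.
        allSquares-sparse : ∀ x (f : Event → ℕ) W →
          (∀ {ev} → ev ∈ allSquares x → ℓ * f ev * product (map weight (map proj₁ ev)) ≤ weight x * W) →
          ℓ * ∑ f (allSquares x) + weight x * W ≤ ℓ * W
        allSquares-sparse x f W f≤ = *-cancelˡ-≤ 8 (begin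
          8 * (ℓ * ∑ f (allSquares x) + weight x * W)          ≡⟨ *-distribˡ-+ 8 (ℓ * ∑ f (allSquares x)) (weight x * W) ⟩
          8 * (ℓ * ∑ f (allSquares x)) + 8 * (weight x * W)    ≡⟨ cong (λ t → 8 * t + 8 * (weight x * W)) total ⟩
          8 * sum (applyUpTo B (n G + m G)) + 8 * (weight x * W)
                                                               ≤⟨ +-monoˡ-≤ _ (geometric-series (n G + m G) 0 (load x * W) B B≤) ⟩
          9 * (load x * W) + 8 * (weight x * W)                ≡⟨ eq (load x) (weight x) W ⟩
          (9 * load x + 8 * weight x) * W                      ≤⟨ *-monoˡ-≤ W (load-weight x) ⟩
          8 * ℓ * W                                            ≡⟨ *-assoc 8 ℓ W ⟩
          8 * (ℓ * W)                                          ∎)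
          where
          open ≤-Reasoning
          eq : ∀ a b W → 9 * (a * W) + 8 * (b * W) ≡ (9 * a + 8 * b) * W
          eq = solve-∀

          B : ℕ → ℕ
          B k = ℓ * ∑ f (squares x k)

          total : ℓ * ∑ f (allSquares x) ≡ sum (applyUpTo B (n G + m G))
          total = trans (cong (ℓ *_) (trans (∑-concat f (map (squares x) (upTo (n G + m G))))
                    (trans (∑-map (∑ f) (squares x) (upTo (n G + m G))) (cong sum (map-upTo (∑ f ∘ squares x) (n G + m G))))))
                  (sym (sum-applyUpTo-* ℓ (∑ f ∘ squares x) (n G + m G)))

          Δ^≢0 : ∀ k → NonZero (Δ ^ k)
          Δ^≢0 k = m^n≢0 Δ k {{>-nonZero (≤-trans (s≤s z≤n) Δ≥36)}}

          term≤ : ∀ k {ev} → ev ∈ squares x k → geometric (suc k) * Δ ^ suc k * (ℓ * f ev) ≤ weight x * W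
          term≤ k {ev} ev∈ with _ , len , (l , u) , _ ← ∈-filter⁻ (halvedAt? x (suc k)) {xs = halvings x k} ev∈ = begin
            geometric (suc k) * Δ ^ suc k * (ℓ * f ev)        ≡⟨ cong (λ j → geometric j * Δ ^ j * (ℓ * f ev)) (trans (length-map proj₁ ev) len) ⟨
            geometric (length Y) * Δ ^ length Y * (ℓ * f ev)  ≤⟨ *-monoˡ-≤ (ℓ * f ev) (weight-product (Linked-++⁻ˡ Y l)) ⟩
            product (map weight Y) * (ℓ * f ev)               ≡⟨ *-comm (product (map weight Y)) (ℓ * f ev) ⟩
            ℓ * f ev * product (map weight Y)                 ≤⟨ f≤ (∈-concatMap⁺ (squares x) (lose (∈-upTo⁺ k<) ev∈)) ⟩
            weight x * W                                      ∎
            where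
            Y = map proj₁ ev
            -- Here `k` is arbitrary, so the range comes from `ev` itself, whose first half is a
            -- mixed path of length `suc k`.
            k< : k < n G + m G
            k< = subst (_≤ n G + m G) (trans (length-map proj₁ ev) len) (mixed-length (mixed-++⁻ˡ Y (l , u)))

          B≤ : ∀ k → geometric (suc k) * B k ≤ (suc k + 0) * (load x * W)
          B≤ k = *-cancelˡ-≤ (Δ ^ suc k) {{Δ^≢0 (suc k)}} (begin
            Δ ^ suc k * (geometric (suc k) * (ℓ * ∑ f (squares x k)))   ≡⟨ eq₁ (Δ ^ suc k) (geometric (suc k)) ℓ (∑ f (squares x k)) ⟩
            geometric (suc k) * Δ ^ suc k * ℓ * ∑ f (squares x k)       ≡⟨ ∑-distrib-*ˡ (geometric (suc k) * Δ ^ suc k * ℓ) f (squares x k) ⟨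
            ∑ (λ ev → geometric (suc k) * Δ ^ suc k * ℓ * f ev) (squares x k)
                 ≤⟨ ∑-≤-const (squares x k) (λ {ev} ev∈ → ≤-trans (≤-reflexive (*-assoc (geometric (suc k) * Δ ^ suc k) ℓ (f ev))) (term≤ k ev∈)) ⟩
            length (squares x k) * (weight x * W)                       ≤⟨ *-monoˡ-≤ (weight x * W) (squares-length x k) ⟩
            suc k * armsBound x k * (weight x * W)                      ≡⟨ eq₂ (suc k) (armsBound x k) (weight x) W ⟩
            suc k * (armsBound x k * weight x * W)                      ≡⟨ cong (λ t → suc k * (t * W)) (armsBound-weight x k) ⟩
            suc k * (Δ ^ suc k * load x * W)                            ≡⟨ eq₃ (suc k) (Δ ^ suc k) (load x) W ⟩
            Δ ^ suc k * ((suc k + 0) * (load x * W))                    ∎)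
            where
            eq₁ : ∀ d g ℓ s → d * (g * (ℓ * s)) ≡ g * d * ℓ * s
            eq₁ = solve-∀
            eq₂ : ∀ k a w W → k * a * (w * W) ≡ k * (a * w * W)
            eq₂ = solve-∀
            eq₃ : ∀ k d a W → k * (d * a * W) ≡ d * ((k + 0) * (a * W))
            eq₃ = solve-∀

        squareSystem : EventSystem (Element G) ℓ
        squareSystem = record
          { β        = weight
          ; events   = allSquares
          ; unique   = λ {x} → proj₂ ∘ proj₁ ∘ allSquares-sound x
          ; first    = λ {x} → proj₂ ∘ allSquares-sound x
          ; transfer = λ {x} {z} → allSquares-transfer {x} {z}
          ; sparse   = allSquares-sparse
          ; β-pos    = λ x → ≤-trans (*-mono-≤ {1} {2} (s≤s z≤n) Δ>0) (2Δ≤weight x)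
          ; ℓ-pos    = *-cancelˡ-< 4 0 ℓ (≤-trans (*-mono-≤ {1} {17} (s≤s z≤n) Δ>0) ℓ-large)
          }
          where
          Δ>0 : 1 ≤ Δ
          Δ>0 = ≤-trans (s≤s z≤n) Δ≥36

  -- From unmatched squares to the theorem

  allSquares-unmatched⇒thue : ∀ {c} → (∀ {x ev} → ev ∈ allSquares x → ¬ Matched c ev) → WeakTotalThue G c
  allSquares-unmatched⇒thue {c} unmatched P P-mixed (pre , xs , suf , xs≢[] , eq)
    -- The repetition in the colours is lifted to consecutive pieces `Y` and `Z` of the path. As
    -- `xs` is nonempty, `Y` has a head, and the square is among the events listed there.
    with Q , R , refl , _ , R≡ ← map-++⁻ c P pre eq
    with S , T , refl , S≡ , _ ← map-++⁻ c R (xs ++ xs) R≡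
    with Y , Z , refl , Y≡ , Z≡ ← map-++⁻ c S xs S≡
    with Y
  ... | []    = xs≢[] (sym Y≡)
  ... | x ∷ Y = unmatched {x} (allSquares-complete {x} {x ∷ Y} {Z} (mixed-++⁻ˡ (x ∷ Y ++ Z) (mixed-++⁻ʳ Q P-mixed)) lengths (here refl))
                  (map≡⇒matched c (x ∷ Y) Z (trans Y≡ (sym Z≡)))
    where
    lengths : suc (length Y) ≡ length Z
    lengths = trans (sym (length-map c (x ∷ Y))) (trans (cong length (trans Y≡ (sym Z≡))) (length-map c Z))

-- The remainder modulo 4 is at most 3, which the added 3 makes up for.
ceil425-large : ∀ Δ → 17 * Δ ≤ 4 * ceil425 Δ
ceil425-large Δ = +-cancelˡ-≤ 3 _ _ (begin
  3 + 17 * Δ                                             ≡⟨ +-comm 3 (17 * Δ) ⟩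
  17 * Δ + 3                                             ≡⟨ m≡m%n+[m/n]*n (17 * Δ + 3) 4 ⟩
  (17 * Δ + 3) % 4 + ceil425 Δ * 4                       ≤⟨ +-mono-≤ (≤-pred (m%n<n (17 * Δ + 3) 4)) (≤-reflexive (*-comm (ceil425 Δ) 4)) ⟩
  3 + 4 * ceil425 Δ                                      ∎)
  where open ≤-Reasoning

theorem4 : (G : Graph) (Δ : ℕ) → MaxDegree G Δ → 300 ≤ Δ →
    WeakTotalThueChoosable G (ceil425 Δ)
theorem4 G Δ (degree≤ , _) 300≤Δ L L≥ = case avoiding-colouring of λ (c , c∈L , unmatched) →
  c , c∈L , allSquares-unmatched⇒thue G (λ {x} → unmatched {x})
  where
  open Counting (elementsIndex G)
    (squareSystem G Δ degree≤ (≤-trans (m≤m+n 36 264) 300≤Δ) (ceil425-large Δ)) L (proj₁ ∘ L≥) (proj₂ ∘ L≥)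
    using (avoiding-colouring)
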